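{- There is no regular graph of degree $d\ge3$, diameter $4$ and cyclic defect, nor any regular graph of odd degree $d\ge3$, girth $9$ and cyclic excess.
   Context: For an integer $d\ge 1$ define polynomials $G_{d,m}(x)$ by $G_{d,0}(x)=1$, $G_{d,1}(x)=x+1$, and $G_{d,m+1}(x)=xG_{d,m}(x)-(d-1)G_{d,m-1}(x)$ for $m\ge1$. Let $J_n$ be the $n\times n$ all-ones matrix. For a graph on $n\ge3$ vertices, a cycle matrix is the adjacency matrix $B$ of an $n$-cycle on the same vertex set (i.e., for some ordering $v_1,\dots,v_n$ of the vertices, $B_{ij}=1$ iff $v_i,v_j$ are cyclically consecutive, and $0$ otherwise); this cycle need not consist of edges of the graph. A graph $\Gamma$ of order $n$ with adjacency matrix $A$ is a graph of degree $d$, diameter $D$ and cyclic defect if $\Gamma$ is $d$-regular with $d\ge3$, has diameter $D\ge2$, and $G_{d,D}(A)=J_n+B$ for some cycle matrix $B$. It is a graph of degree $d$, girth $g$ and cyclic excess if $\Gamma$ is $d$-regular with $d\ge3$, has odd girth $g\ge5$, and $G_{d,\lfloor g/2\rfloor}(A)=J_n-B$ for some cycle matrix $B$. -}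

module Defs where

open import Data.Nat using (ℕ; zero; suc; _≤_; _<_; _∸_)
open import Data.Nat.Base using (_≡ᵇ_)
open import Data.Bool using (Bool; true; false; if_then_else_; _∨_; _∧_; T)
open import Data.Fin using (Fin; toℕ) renaming (zero to fzero; suc to fsuc)
open import Data.Integer using (ℤ; +_; _+_; _*_; _-_)
open import Data.Product using (Σ; ∃; ∃-syntax; _×_)
open import Relation.Binary.PropositionalEquality using (_≡_)
open import Function.Definitions using (Bijective)
open import Relation.Nullary using (¬_)

record Graph (n : ℕ) : Set where
  field
    adj     : Fin n → Fin n → Bool
    symm    : ∀ u v → adj u v ≡ adj v u
    irrefl  : ∀ v → adj v v ≡ false
open Graph public

Mat : ℕ → Set
Mat n = Fin n → Fin n → ℤ

sumFin : (n : ℕ) → (Fin n → ℤ) → ℤ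
sumFin zero    f = + 0
sumFin (suc n) f = f fzero + sumFin n (λ i → f (fsuc i))

infixl 7 _⊛_
_⊛_ : {n : ℕ} → Mat n → Mat n → Mat n
_⊛_ {n} M N i j = sumFin n (λ k → M i k * N k j)

_⊕_ _⊖_ : {n : ℕ} → Mat n → Mat n → Mat n
(M ⊕ N) i j = M i j + N i j
(M ⊖ N) i j = M i j - N i j

scale : {n : ℕ} → ℤ → Mat n → Mat n
scale c M i j = c * M i j

bool→ℤ : Bool → ℤ
bool→ℤ b = if b then + 1 else + 0

_==_ : {n : ℕ} → Fin n → Fin n → Bool
i == j = toℕ i ≡ᵇ toℕ j

idMat : {n : ℕ} → Mat n
idMat i j = bool→ℤ (i == j)

allOnes : {n : ℕ} → Mat n
allOnes i j = + 1

adjMat : {n : ℕ} → Graph n → Mat n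
adjMat Γ i j = bool→ℤ (adj Γ i j)

Gpoly : {n : ℕ} → (d m : ℕ) → Mat n → Mat n
Gpoly d zero          A = idMat
Gpoly d (suc zero)    A = A ⊕ idMat
Gpoly d (suc (suc m)) A = (A ⊛ Gpoly d (suc m) A) ⊖ scale (+ (d ∸ 1)) (Gpoly d m A)

cyclicAdj : {n : ℕ} → Fin n → Fin n → Bool
cyclicAdj {n} i j =
  (toℕ j ≡ᵇ suc (toℕ i)) ∨ (toℕ i ≡ᵇ suc (toℕ j))
  ∨ ((toℕ i ≡ᵇ 0) ∧ (toℕ j ≡ᵇ (n ∸ 1)))
  ∨ ((toℕ j ≡ᵇ 0) ∧ (toℕ i ≡ᵇ (n ∸ 1)))

IsCycleMatrix : {n : ℕ} → Mat n → Set
IsCycleMatrix {n} B =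
  Σ (Fin n → Fin n) λ p → Bijective _≡_ _≡_ p ×
    (∀ i j → B (p i) (p j) ≡ bool→ℤ (cyclicAdj i j))

IsRegular : {n : ℕ} → Graph n → ℕ → Set
IsRegular {n} Γ d = ∀ v → sumFin n (λ u → adjMat Γ v u) ≡ + d

data Walk {n : ℕ} (Γ : Graph n) : ℕ → Fin n → Fin n → Set where
  nil  : ∀ {u} → Walk Γ 0 u u
  cons : ∀ {k u w v} → T (adj Γ u w) → Walk Γ k w v → Walk Γ (suc k) u v

HasDiameter : {n : ℕ} → Graph n → ℕ → Set
HasDiameter {n} Γ D =
  (∀ u v → ∃[ m ] (m ≤ D × Walk Γ m u v)) ×
  (∃[ u ] ∃[ v ] (∀ m → Walk Γ m u v → D ≤ m))

HasCycleOfLength : {n : ℕ} → Graph n → ℕ → Set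
HasCycleOfLength {n} Γ k =
  3 ≤ k × Σ (Fin k → Fin n) λ f →
    (∀ i j → f i ≡ f j → i ≡ j) ×
    (∀ i j → T (cyclicAdj i j) → T (adj Γ (f i) (f j)))

HasGirth : {n : ℕ} → Graph n → ℕ → Set
HasGirth Γ g = HasCycleOfLength Γ g × (∀ k → k < g → ¬ HasCycleOfLength Γ k)

Odd : ℕ → Set
Odd m = ∃[ k ] m ≡ suc (k Data.Nat.* 2)
  where import Data.Nat

CyclicDefect : {n : ℕ} → Graph n → ℕ → ℕ → Set
CyclicDefect {n} Γ d D =
  3 ≤ n × IsRegular Γ d × 3 ≤ d × HasDiameter Γ D × 2 ≤ D ×
  ∃[ B ] (IsCycleMatrix B × (∀ i j → Gpoly d D (adjMat Γ) i j ≡ (allOnes ⊕ B) i j))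

CyclicExcess : {n : ℕ} → Graph n → ℕ → ℕ → Set
CyclicExcess {n} Γ d g =
  3 ≤ n × IsRegular Γ d × 3 ≤ d × HasGirth Γ g × Odd g × 5 ≤ g ×
  ∃[ B ] (IsCycleMatrix B ×
    (∀ i j → Gpoly d (Data.Nat._/_ g 2) (adjMat Γ) i j ≡ (allOnes ⊖ B) i j))
  where import Data.Nat

{-# OPTIONS --safe #-}
module Submission where

-- Write G₄(A) = J + εB with ε = ±1. As A commutes with J and with G₄(A), it commutes with B. Naming the
-- vertices 0, …, n-1 along the cycle, this is a discrete wave equation on the torus for the entries
-- u(i, j) of A, whose solutions are f(i - j) + g(i + j). The zero diagonal makes g constant on even
-- arguments; as u takes only the values 0 and 1, either A is circulant, or n is even, u(i, j) depends on
-- i - j alone when i + j is even and on i + j alone when i + j is odd.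
-- G₄(A) has diagonal 1, which forbids 4-cycles. Hence neither A is circulant nor can vertex 0 have two
-- neighbours of even index, or one of each parity. So all neighbours have odd index, A is bipartite, and
-- the alternating vector is an eigenvector of A, J and B for -d, 0 and -2. This yields
-- G₄(-d) = -2ε, whereas G₄(-d) ≥ 16.

open import Defs
open import Algebra.Properties.AbelianGroup using (∙-cancelˡ)
import Algebra.Properties.Semiring.Sum
open import Data.Bool as Bool using (Bool; true; false; T; _∨_; _∧_)
open import Data.Bool.Properties using (T-∨; T-∧; ¬-not)
open import Data.Empty using (⊥; ⊥-elim)
open import Data.Fin using (Fin; toℕ) renaming (zero to fzero; suc to fsuc)
open import Data.Fin.Permutation using (Permutation′; _⟨$⟩ʳ_)
import Data.Fin.Properties as Fin
open import Data.Integer hiding (_⊖_; suc; NonZero; _%_; _/_)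
open import Data.Integer.Properties
open import Data.Integer.Tactic.RingSolver using (solve-∀)
open import Data.Nat as ℕ using (ℕ; zero; suc; NonZero)
open import Data.Nat.DivMod
  using (_%_; _/_; _mod_; m≡m%n+[m/n]*n; [m+kn]%n≡m%n; m<n⇒m%n≡m; m%n<n; n%n≡0)
import Data.Nat.Properties as ℕ
open import Data.Nat.Tactic.RingSolver using () renaming (solve-∀ to ℕ-solve-∀)
open import Data.Product using (∃; _×_; _,_; proj₁; proj₂)
open import Data.Sum using (_⊎_; inj₁; inj₂; [_,_]′)
open import Function using (_∘_; Injective; Bijective; mk⤖; module Equivalence)
open import Function.Properties.Bijection using (⤖⇒↔)
open import Relation.Binary.PropositionalEquality
open import Relation.Nullary using (¬_; yes; no; contradiction)
open import Relation.Nullary.Decidable using (¬?; _×-dec_; decidable-stable)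

open Equivalence using (to; from)
open ≡-Reasoning

private module Sum = Algebra.Properties.Semiring.Sum +-*-semiring

-- Finite sums

sumFin≡sum : ∀ n f → sumFin n f ≡ Sum.sum f
sumFin≡sum zero    f = refl
sumFin≡sum (suc n) f = cong (λ x → f fzero + x) (sumFin≡sum n (f ∘ fsuc))

sumFin-cong : ∀ {n f g} → f ≗ g → sumFin n f ≡ sumFin n g
sumFin-cong {zero}  f≗g = refl
sumFin-cong {suc n} f≗g = cong₂ _+_ (f≗g fzero) (sumFin-cong (f≗g ∘ fsuc))

sumFin-+ : ∀ {n} f g → sumFin n (λ k → f k + g k) ≡ sumFin n f + sumFin n g
sumFin-+ {n} f g
  rewrite sumFin≡sum n (λ k → f k + g k) | sumFin≡sum n f | sumFin≡sum n g = Sum.∑-distrib-+ f g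

sumFin-* : ∀ {n} c f → sumFin n (λ k → c * f k) ≡ c * sumFin n f
sumFin-* {n} c f
  rewrite sumFin≡sum n (λ k → c * f k) | sumFin≡sum n f = sym (Sum.*-distribˡ-sum c f)

sumFin-linear : ∀ {n} c f g → sumFin n (λ k → f k + c * g k) ≡ sumFin n f + c * sumFin n g
sumFin-linear c f g = trans (sumFin-+ f (λ k → c * g k)) (cong (λ x → sumFin _ f + x) (sumFin-* c g))

sumFin-swap : ∀ {m n} (f : Fin m → Fin n → ℤ) →
              sumFin m (λ i → sumFin n (f i)) ≡ sumFin n (λ j → sumFin m (λ i → f i j))
sumFin-swap {m} {n} f = begin
  sumFin m (λ i → sumFin n (f i))            ≡⟨ sumFin-cong (λ i → sumFin≡sum n (f i)) ⟩
  sumFin m (λ i → Sum.sum (f i))             ≡⟨ sumFin≡sum m _ ⟩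
  Sum.sum (λ i → Sum.sum (f i))              ≡⟨ Sum.∑-comm f ⟩
  Sum.sum (λ j → Sum.sum (λ i → f i j))      ≡⟨ sumFin≡sum n _ ⟨
  sumFin n (λ j → Sum.sum (λ i → f i j))     ≡⟨ sumFin-cong (λ j → sumFin≡sum m (λ i → f i j)) ⟨
  sumFin n (λ j → sumFin m (λ i → f i j))    ∎

sumFin-permute : ∀ {n} (π : Permutation′ n) f → sumFin n (λ k → f (π ⟨$⟩ʳ k)) ≡ sumFin n f
sumFin-permute {n} π f = begin
  sumFin n (λ k → f (π ⟨$⟩ʳ k))   ≡⟨ sumFin≡sum n _ ⟩
  Sum.sum (λ k → f (π ⟨$⟩ʳ k))    ≡⟨ Sum.sum-permute f π ⟨
  Sum.sum f                       ≡⟨ sumFin≡sum n f ⟨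
  sumFin n f                      ∎

sumFin-0 : ∀ n → sumFin n (λ _ → + 0) ≡ + 0
sumFin-0 zero    = refl
sumFin-0 (suc n) = trans (+-identityˡ _) (sumFin-0 n)

sumFin-idMat : ∀ {n} (f : Fin n → ℤ) j → sumFin n (λ k → f k * idMat k j) ≡ f j
sumFin-idMat {suc n} f fzero = begin
  f fzero * + 1 + sumFin n (λ k → f (fsuc k) * + 0)
    ≡⟨ cong₂ _+_ (*-identityʳ (f fzero)) (trans (sumFin-cong (λ k → *-zeroʳ (f (fsuc k)))) (sumFin-0 n)) ⟩
  f fzero + + 0
    ≡⟨ +-identityʳ _ ⟩
  f fzero ∎
sumFin-idMat {suc n} f (fsuc j) = begin
  f fzero * + 0 + sumFin n (λ k → f (fsuc k) * idMat k j)
    ≡⟨ cong₂ _+_ (*-zeroʳ (f fzero)) (sumFin-idMat (f ∘ fsuc) j) ⟩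
  + 0 + f (fsuc j)
    ≡⟨ +-identityˡ _ ⟩
  f (fsuc j) ∎

sumFin-mono : ∀ {n f g} → (∀ k → f k ≤ g k) → sumFin n f ≤ sumFin n g
sumFin-mono {zero}  f≤g = ≤-refl
sumFin-mono {suc n} f≤g = +-mono-≤ (f≤g fzero) (sumFin-mono (f≤g ∘ fsuc))

sumFin-nonneg : ∀ {n f} → (∀ k → + 0 ≤ f k) → + 0 ≤ sumFin n f
sumFin-nonneg {n} 0≤f = ≤-trans (≤-reflexive (sym (sumFin-0 n))) (sumFin-mono 0≤f)

term≤sumFin : ∀ {n f} → (∀ k → + 0 ≤ f k) → ∀ i → f i ≤ sumFin n f
term≤sumFin {f = f} 0≤f fzero =
  ≤-trans (≤-reflexive (sym (+-identityʳ _))) (+-monoʳ-≤ (f fzero) (sumFin-nonneg (0≤f ∘ fsuc)))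
term≤sumFin 0≤f (fsuc i) =
  ≤-trans (≤-reflexive (sym (+-identityˡ _))) (+-mono-≤ (0≤f fzero) (term≤sumFin (0≤f ∘ fsuc) i))

two-terms≤sumFin : ∀ {n f} → (∀ k → + 0 ≤ f k) → ∀ {i j} → i ≢ j → f i + f j ≤ sumFin n f
two-terms≤sumFin 0≤f {fzero}  {fzero}  i≢j = contradiction refl i≢j
two-terms≤sumFin {f = f} 0≤f {fzero}  {fsuc j} i≢j = +-monoʳ-≤ (f fzero) (term≤sumFin (0≤f ∘ fsuc) j)
two-terms≤sumFin {f = f} 0≤f {fsuc i} {fzero} i≢j =
  ≤-trans (≤-reflexive (+-comm (f (fsuc i)) (f fzero))) (+-monoʳ-≤ (f fzero) (term≤sumFin (0≤f ∘ fsuc) i))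
two-terms≤sumFin 0≤f {fsuc i} {fsuc j} i≢j =
  ≤-trans (≤-reflexive (sym (+-identityˡ _)))
          (+-mono-≤ (0≤f fzero) (two-terms≤sumFin (0≤f ∘ fsuc) (i≢j ∘ cong fsuc)))

-- Indicators

bool-nonneg : ∀ b → + 0 ≤ bool→ℤ b
bool-nonneg true  = +≤+ ℕ.z≤n
bool-nonneg false = ≤-refl

bool-≤1 : ∀ b → bool→ℤ b ≤ + 1
bool-≤1 true  = ≤-refl
bool-≤1 false = +≤+ ℕ.z≤n

bool→ℤ-injective : ∀ {a b} → bool→ℤ a ≡ bool→ℤ b → a ≡ b
bool→ℤ-injective {true}  {true}  _ = refl
bool→ℤ-injective {false} {false} _ = refl

bool→ℤ-cong : ∀ {a b} → (T a → T b) → (T b → T a) → bool→ℤ a ≡ bool→ℤ b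
bool→ℤ-cong {true}  {true}  _ _ = refl
bool→ℤ-cong {true}  {false} f _ = ⊥-elim (f _)
bool→ℤ-cong {false} {true}  _ g = ⊥-elim (g _)
bool→ℤ-cong {false} {false} _ _ = refl

bool→ℤ-⊎ : ∀ {a b c} → (T a → T b ⊎ T c) → (T b → T a) → (T c → T a) → ¬ (T b × T c) →
           bool→ℤ a ≡ bool→ℤ b + bool→ℤ c
bool→ℤ-⊎ {true}  {true}  {true}  _ _ _ h = ⊥-elim (h _)
bool→ℤ-⊎ {true}  {true}  {false} _ _ _ _ = refl
bool→ℤ-⊎ {true}  {false} {true}  _ _ _ _ = refl
bool→ℤ-⊎ {true}  {false} {false} h _ _ _ with h _
... | inj₁ ()
... | inj₂ ()
bool→ℤ-⊎ {false} {true}          _ h _ _ = ⊥-elim (h _)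
bool→ℤ-⊎ {false} {false} {true}  _ _ h _ = ⊥-elim (h _)
bool→ℤ-⊎ {false} {false} {false} _ _ _ _ = refl

-- A nonzero difference of two bits fixes both of them: 1 is a step up from `false`, -1 a step down
-- from `true`. Equal nonzero differences therefore start at the same bit.
bits-determined : ∀ {a a′ b b′} → bool→ℤ a′ - bool→ℤ a ≢ + 0 →
                  bool→ℤ a′ - bool→ℤ a ≡ bool→ℤ b′ - bool→ℤ b → a ≡ b
bits-determined {true}  {true}                  ≢0 _ = contradiction refl ≢0
bits-determined {false} {false}                 ≢0 _ = contradiction refl ≢0
bits-determined {true}  {false} {true}          _  _ = refl
bits-determined {false} {true}  {false}         _  _ = refl
bits-determined {true}  {false} {false} {true}  _ ()
bits-determined {true}  {false} {false} {false} _ ()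
bits-determined {false} {true}  {true}  {true}  _ ()
bits-determined {false} {true}  {true}  {false} _ ()

==⇒≡ : ∀ {n} (i j : Fin n) → T (i == j) → i ≡ j
==⇒≡ i j = Fin.toℕ-injective ∘ ℕ.≡ᵇ⇒≡ (toℕ i) (toℕ j)

≡⇒== : ∀ {n} (i j : Fin n) → i ≡ j → T (i == j)
≡⇒== i j = ℕ.≡⇒≡ᵇ (toℕ i) (toℕ j) ∘ cong toℕ

idMat-refl : ∀ {n} (i : Fin n) → idMat i i ≡ + 1
idMat-refl i = bool→ℤ-cong {b = true} _ (λ _ → ≡⇒== i i refl)

idMat-injective : ∀ {m n} {p : Fin m → Fin n} → Injective _≡_ _≡_ p →
                  ∀ i j → idMat (p i) (p j) ≡ idMat i j
idMat-injective {p = p} inj i j =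
  bool→ℤ-cong {p i == p j} {i == j}
    (≡⇒== i j ∘ inj ∘ ==⇒≡ (p i) (p j)) (≡⇒== (p i) (p j) ∘ cong p ∘ ==⇒≡ i j)

idMat-sym : ∀ {n} (i j : Fin n) → idMat i j ≡ idMat j i
idMat-sym i j = bool→ℤ-cong {i == j} {j == i}
  (≡⇒== j i ∘ sym ∘ ==⇒≡ i j) (≡⇒== i j ∘ sym ∘ ==⇒≡ j i)

-- Otherwise `f` would be bounded pointwise by the indicators of `x` and `y`, whose total is 2.
-- Applied to a row of the adjacency matrix, this lets a neighbour avoid two prescribed vertices.
true-outside-pair : ∀ {n} (f : Fin n → Bool) → + 3 ≤ sumFin n (bool→ℤ ∘ f) →
                    ∀ x y → ∃ λ z → f z ≡ true × z ≢ x × z ≢ y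
true-outside-pair {n} f 3≤Σf x y
  with Fin.any? (λ z → f z Bool.≟ true ×-dec ¬? (z Fin.≟ x) ×-dec ¬? (z Fin.≟ y))
... | yes found = found
... | no none =
  contradiction (≤-trans 3≤Σf (≤-trans (sumFin-mono bound) (≤-reflexive total)))
                λ { (+≤+ (ℕ.s≤s (ℕ.s≤s ()))) }
  where
  -- The factor `+ 1` puts the indicators in the shape that `sumFin-idMat` sums.
  0≤idMat : ∀ i j → + 0 ≤ + 1 * idMat {n} i j
  0≤idMat i j = ≤-trans (bool-nonneg (i == j)) (≤-reflexive (sym (*-identityˡ _)))
  bound : ∀ z → bool→ℤ (f z) ≤ + 1 * idMat z x + + 1 * idMat z y
  bound z with z Fin.≟ x | z Fin.≟ y | f z in fz
  ... | yes refl | _ | b rewrite idMat-refl z = ≤-trans (bool-≤1 b)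
          (≤-trans (≤-reflexive (sym (+-identityʳ (+ 1)))) (+-monoʳ-≤ (+ 1) (0≤idMat z y)))
  ... | no _ | yes refl | b rewrite idMat-refl z = ≤-trans (bool-≤1 b)
          (≤-trans (≤-reflexive (sym (+-identityˡ (+ 1)))) (+-monoˡ-≤ (+ 1) (0≤idMat z x)))
  ... | no z≢x | no z≢y | true  = contradiction (z , fz , z≢x , z≢y) none
  ... | no z≢x | no z≢y | false = +-mono-≤ (0≤idMat z x) (0≤idMat z y)
  total : sumFin n (λ z → + 1 * idMat z x + + 1 * idMat z y) ≡ + 2
  total = trans (sumFin-+ {n} (λ z → + 1 * idMat z x) (λ z → + 1 * idMat z y))
                (cong₂ _+_ (sumFin-idMat (λ _ → + 1) x) (sumFin-idMat (λ _ → + 1) y))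

-- Matrices

⊛-congˡ : ∀ {n} (M : Mat n) {N P : Mat n} → (∀ i j → N i j ≡ P i j) →
          ∀ i j → (M ⊛ N) i j ≡ (M ⊛ P) i j
⊛-congˡ M N≡P i j = sumFin-cong (λ k → cong (M i k *_) (N≡P k j))

⊛-assoc : ∀ {n} (M N P : Mat n) i j → ((M ⊛ N) ⊛ P) i j ≡ (M ⊛ (N ⊛ P)) i j
⊛-assoc {n} M N P i j = begin
  sumFin n (λ k → sumFin n (λ l → M i l * N l k) * P k j)
    ≡⟨ sumFin-cong (λ k → trans (*-comm ((M ⊛ N) i k) (P k j))
         (trans (sym (sumFin-* (P k j) (λ l → M i l * N l k)))
                (sumFin-cong (λ l → rearrange (P k j) (M i l) (N l k))))) ⟩
  sumFin n (λ k → sumFin n (λ l → M i l * (N l k * P k j)))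
    ≡⟨ sumFin-swap (λ k l → M i l * (N l k * P k j)) ⟩
  sumFin n (λ l → sumFin n (λ k → M i l * (N l k * P k j)))
    ≡⟨ sumFin-cong (λ l → sumFin-* (M i l) (λ k → N l k * P k j)) ⟩
  sumFin n (λ l → M i l * sumFin n (λ k → N l k * P k j)) ∎
  where
  rearrange : ∀ p m n → p * (m * n) ≡ m * (n * p)
  rearrange = solve-∀

⊛-identityʳ : ∀ {n} (M : Mat n) i j → (M ⊛ idMat) i j ≡ M i j
⊛-identityʳ M i = sumFin-idMat (M i)

⊛-identityˡ : ∀ {n} (M : Mat n) i j → (idMat ⊛ M) i j ≡ M i j
⊛-identityˡ M i j =
  trans (sumFin-cong (λ k → trans (*-comm (idMat i k) (M k j)) (cong (M k j *_) (idMat-sym i k))))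
        (sumFin-idMat (λ k → M k j) i)

⊛-distribˡ-⊕ : ∀ {n} (M N P : Mat n) i j → (M ⊛ (N ⊕ P)) i j ≡ ((M ⊛ N) ⊕ (M ⊛ P)) i j
⊛-distribˡ-⊕ M N P i j =
  trans (sumFin-cong (λ k → *-distribˡ-+ (M i k) (N k j) (P k j)))
        (sumFin-+ (λ k → M i k * N k j) (λ k → M i k * P k j))

⊛-distribʳ-⊕ : ∀ {n} (M N P : Mat n) i j → ((N ⊕ P) ⊛ M) i j ≡ ((N ⊛ M) ⊕ (P ⊛ M)) i j
⊛-distribʳ-⊕ M N P i j =
  trans (sumFin-cong (λ k → *-distribʳ-+ (M k j) (N i k) (P i k)))
        (sumFin-+ (λ k → N i k * M k j) (λ k → P i k * M k j))

⊛-distribˡ-⊖scale : ∀ {n} c (M N P : Mat n) i j →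
                    (M ⊛ (N ⊖ scale c P)) i j ≡ ((M ⊛ N) ⊖ scale c (M ⊛ P)) i j
⊛-distribˡ-⊖scale c M N P i j =
  trans (sumFin-cong (λ k → expand c (M i k) (N k j) (P k j)))
        (trans (sumFin-linear (- c) (λ k → M i k * N k j) (λ k → M i k * P k j)) (collect c ((M ⊛ N) i j) ((M ⊛ P) i j)))
  where
  expand : ∀ c m n p → m * (n - c * p) ≡ m * n + (- c) * (m * p)
  expand = solve-∀
  collect : ∀ c x y → x + (- c) * y ≡ x - c * y
  collect = solve-∀

⊛-distribʳ-⊖scale : ∀ {n} c (M N P : Mat n) i j →
                    ((N ⊖ scale c P) ⊛ M) i j ≡ ((N ⊛ M) ⊖ scale c (P ⊛ M)) i j
⊛-distribʳ-⊖scale c M N P i j =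
  trans (sumFin-cong (λ k → expand c (M k j) (N i k) (P i k)))
        (trans (sumFin-linear (- c) (λ k → N i k * M k j) (λ k → P i k * M k j)) (collect c ((N ⊛ M) i j) ((P ⊛ M) i j)))
  where
  expand : ∀ c m n p → (n - c * p) * m ≡ n * m + (- c) * (p * m)
  expand = solve-∀
  collect : ∀ c x y → x + (- c) * y ≡ x - c * y
  collect = solve-∀

-- Polynomials in a matrix: commutation and eigenvectors

Gpoly-commutes : ∀ {n} (A : Mat n) d m i j → (A ⊛ Gpoly d m A) i j ≡ (Gpoly d m A ⊛ A) i j
Gpoly-commutes A d zero i j = trans (⊛-identityʳ A i j) (sym (⊛-identityˡ A i j))
Gpoly-commutes A d (suc zero) i j = begin
  (A ⊛ (A ⊕ idMat)) i j            ≡⟨ ⊛-distribˡ-⊕ A A idMat i j ⟩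
  (A ⊛ A) i j + (A ⊛ idMat) i j    ≡⟨ cong (λ x → (A ⊛ A) i j + x) (Gpoly-commutes A d zero i j) ⟩
  (A ⊛ A) i j + (idMat ⊛ A) i j    ≡⟨ ⊛-distribʳ-⊕ A A idMat i j ⟨
  ((A ⊕ idMat) ⊛ A) i j            ∎
Gpoly-commutes {n} A d (suc (suc m)) i j = begin
  (A ⊛ ((A ⊛ G′) ⊖ scale q G)) i j           ≡⟨ ⊛-distribˡ-⊖scale q A (A ⊛ G′) G i j ⟩
  (A ⊛ (A ⊛ G′)) i j - q * (A ⊛ G) i j
    ≡⟨ cong₂ (λ x y → x - q * y)
         (trans (⊛-congˡ A (Gpoly-commutes A d (suc m)) i j) (sym (⊛-assoc A G′ A i j)))
         (Gpoly-commutes A d m i j) ⟩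
  ((A ⊛ G′) ⊛ A) i j - q * (G ⊛ A) i j       ≡⟨ ⊛-distribʳ-⊖scale q A (A ⊛ G′) G i j ⟨
  (((A ⊛ G′) ⊖ scale q G) ⊛ A) i j           ∎
  where
  q = + (d ℕ.∸ 1)
  G G′ : Mat n
  G  = Gpoly d m A
  G′ = Gpoly d (suc m) A

Geval : ℕ → ℕ → ℤ → ℤ
Geval d zero          x = + 1
Geval d (suc zero)    x = x + + 1
Geval d (suc (suc m)) x = x * Geval d (suc m) x - + (d ℕ.∸ 1) * Geval d m x

-- Eigenvectors are taken as the columns of a matrix `W`, so that the laws of `⊛` apply to them
-- directly; the matrix recurrence then turns into the scalar one of `Geval`.
Gpoly-eigenvector : ∀ {n} (A W : Mat n) d {μ} → (∀ i j → (A ⊛ W) i j ≡ scale μ W i j) →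
                    ∀ m i j → (Gpoly d m A ⊛ W) i j ≡ scale (Geval d m μ) W i j
Gpoly-eigenvector A W d AW zero i j = trans (⊛-identityˡ W i j) (sym (*-identityˡ (W i j)))
Gpoly-eigenvector A W d {μ} AW (suc zero) i j = begin
  ((A ⊕ idMat) ⊛ W) i j            ≡⟨ ⊛-distribʳ-⊕ W A idMat i j ⟩
  (A ⊛ W) i j + (idMat ⊛ W) i j    ≡⟨ cong₂ _+_ (AW i j) (⊛-identityˡ W i j) ⟩
  μ * W i j + W i j                ≡⟨ collect μ (W i j) ⟩
  (μ + + 1) * W i j                ∎
  where
  collect : ∀ μ w → μ * w + w ≡ (μ + + 1) * w
  collect = solve-∀
Gpoly-eigenvector {n} A W d {μ} AW (suc (suc m)) i j = begin
  (((A ⊛ G′) ⊖ scale q G) ⊛ W) i j            ≡⟨ ⊛-distribʳ-⊖scale q W (A ⊛ G′) G i j ⟩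
  ((A ⊛ G′) ⊛ W) i j - q * (G ⊛ W) i j
    ≡⟨ cong₂ (λ x y → x - q * y)
         (trans (⊛-assoc A G′ W i j) (⊛-congˡ A (Gpoly-eigenvector A W d AW (suc m)) i j))
         (Gpoly-eigenvector A W d AW m i j) ⟩
  (A ⊛ scale g′ W) i j - q * (g * W i j)
    ≡⟨ cong (λ x → x - q * (g * W i j)) (begin
         sumFin n (λ k → A i k * (g′ * W k j))  ≡⟨ sumFin-cong (λ k → pull g′ (A i k) (W k j)) ⟩
         sumFin n (λ k → g′ * (A i k * W k j))  ≡⟨ sumFin-* g′ (λ k → A i k * W k j) ⟩
         g′ * (A ⊛ W) i j                       ≡⟨ cong (g′ *_) (AW i j) ⟩
         g′ * (μ * W i j)                       ∎) ⟩
  g′ * (μ * W i j) - q * (g * W i j)           ≡⟨ collect g′ g μ q (W i j) ⟩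
  (μ * g′ - q * g) * W i j                     ∎
  where
  q = + (d ℕ.∸ 1)
  g = Geval d m μ
  g′ = Geval d (suc m) μ
  G G′ : Mat n
  G  = Gpoly d m A
  G′ = Gpoly d (suc m) A
  pull : ∀ g a w → a * (g * w) ≡ g * (a * w)
  pull = solve-∀
  collect : ∀ g′ g μ q w → g′ * (μ * w) - q * (g * w) ≡ (μ * g′ - q * g) * w
  collect = solve-∀

-- Four-cycles

pairs-nonneg : ∀ s → + 0 ≤ s → + 0 ≤ s * (s - + 1)
pairs-nonneg (+ zero) _ = ≤-refl
pairs-nonneg (+ suc s) _ = ≤-trans (+≤+ ℕ.z≤n) (≤-reflexive (pos-* (suc s) s))

2≤pairs : ∀ s → + 2 ≤ s → + 2 ≤ s * (s - + 1)
2≤pairs (+ suc zero) (+≤+ (ℕ.s≤s ()))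
2≤pairs (+ suc (suc s)) _ =
  +≤+ (ℕ.s≤s (ℕ.≤-trans (ℕ.s≤s ℕ.z≤n) (ℕ.m≤n+m _ s)))

adjMat-sym : ∀ {n} (Γ : Graph n) i j → adjMat Γ i j ≡ adjMat Γ j i
adjMat-sym Γ i j = cong bool→ℤ (symm Γ i j)

module _ {n} (Γ : Graph n) where

  private
    A S : Mat n
    A = adjMat Γ
    S = A ⊛ A

  S-sym : ∀ i k → S i k ≡ S k i
  S-sym i k = sumFin-cong (λ m →
    trans (*-comm (A i m) (A m k)) (cong₂ _*_ (adjMat-sym Γ m k) (adjMat-sym Γ i m)))

  AA-nonneg : ∀ i j k l → + 0 ≤ A i j * A k l
  AA-nonneg i j k l with adj Γ i j | adj Γ k l
  ... | true  | true  = +≤+ ℕ.z≤n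
  ... | true  | false = ≤-refl
  ... | false | _     = ≤-refl

  S-nonneg : ∀ i k → + 0 ≤ S i k
  S-nonneg i k = sumFin-nonneg (λ m → AA-nonneg i m m k)

  -- `S i k` counts the common neighbours of `i` and `k`, and `x` and `y` contribute 1 each.
  S-two-paths : ∀ {i k x y} → x ≢ y →
                adj Γ i x ≡ true → adj Γ k x ≡ true → adj Γ i y ≡ true → adj Γ k y ≡ true →
                + 2 ≤ S i k
  S-two-paths {i} {k} {x} {y} x≢y ix kx iy ky = ≤-trans
    (≤-reflexive (sym (cong₂ _+_ (cong₂ _*_ (one ix) (one xk)) (cong₂ _*_ (one iy) (one yk)))))
    (two-terms≤sumFin (λ m → AA-nonneg i m m k) x≢y)
    where
    one : ∀ {u v} → adj Γ u v ≡ true → A u v ≡ + 1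
    one = cong bool→ℤ
    xk = trans (symm Γ x k) kx
    yk = trans (symm Γ y k) ky

  module _ {q} (reg : IsRegular Γ (suc q)) where

    S-diag : ∀ i → S i i ≡ + suc q
    S-diag i = trans (sumFin-cong (λ m → trans (cong (A i m *_) (adjMat-sym Γ m i)) (square (adj Γ i m)))) (reg i)
      where
      square : ∀ b → bool→ℤ b * bool→ℤ b ≡ bool→ℤ b
      square true  = refl
      square false = refl

    -- A count of the walks of length two from `i`: each of the two steps can be chosen in d ways.
    S-row : ∀ i → sumFin n (S i) ≡ + suc q * + suc q
    S-row i = begin
      sumFin n (λ k → sumFin n (λ m → A i m * A m k))  ≡⟨ sumFin-swap (λ k m → A i m * A m k) ⟩
      sumFin n (λ m → sumFin n (λ k → A i m * A m k))
        ≡⟨ sumFin-cong (λ m → trans (sumFin-* (A i m) (A m))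
             (trans (cong (A i m *_) (reg m)) (*-comm (A i m) (+ suc q)))) ⟩
      sumFin n (λ m → + suc q * A i m)                 ≡⟨ sumFin-* (+ suc q) (A i) ⟩
      + suc q * sumFin n (A i)                         ≡⟨ cong (+ suc q *_) (reg i) ⟩
      + suc q * + suc q                                ∎

    -- As S i i = d, the k = i term of the first sum already equals d(d - 1), so that a diagonal
    -- entry 1 leaves no room for any S i k ≥ 2 with k ≠ i.
    G₄-diag : ∀ i → Gpoly (suc q) 4 A i i ≡
              sumFin n (λ k → S i k * (S i k - + 1)) + sumFin n (λ k → S i k * A i k)
              + + 1 - + suc q * + q
    G₄-diag i = begin
      (A ⊛ ((A ⊛ G₂) ⊖ scale (+ q) G₁)) i i - + q * G₂ i i
        ≡⟨ cong (_- + q * G₂ i i) (⊛-distribˡ-⊖scale (+ q) A (A ⊛ G₂) G₁ i i) ⟩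
      (A ⊛ (A ⊛ G₂)) i i - + q * (A ⊛ G₁) i i - + q * G₂ i i
        ≡⟨ cong₂ (λ x y → x - + q * y - + q * G₂ i i) (trans (sym (⊛-assoc A A G₂ i i)) SG₂) AG₁ ⟩
      P + + suc q * + suc q + R + - + q * + suc q - + q * + suc q - + q * G₂ i i
        ≡⟨ cong (λ x → P + + suc q * + suc q + R + - + q * + suc q - + q * + suc q - + q * x)
             (cong₂ (λ x y → x - + q * y) AG₁ (idMat-refl i)) ⟩
      P + + suc q * + suc q + R + - + q * + suc q - + q * + suc q - + q * (+ suc q - + q * + 1)
        ≡⟨ finish P R (+ q) ⟩
      P + R + + 1 - + suc q * + q ∎
      where
      G₁ G₂ : Mat n
      G₁ = Gpoly (suc q) 1 A
      G₂ = Gpoly (suc q) 2 A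
      P = sumFin n (λ k → S i k * (S i k - + 1))
      R = sumFin n (λ k → S i k * A i k)
      Aii : A i i ≡ + 0
      Aii = cong bool→ℤ (irrefl Γ i)
      AG₁ : (A ⊛ G₁) i i ≡ + suc q
      AG₁ = trans (⊛-distribˡ-⊕ A A idMat i i)
              (trans (cong₂ _+_ (S-diag i) (trans (⊛-identityʳ A i i) Aii)) (+-identityʳ _))
      -- Splitting s² as s(s - 1) + s separates the ordered pairs of distinct two-step paths,
      -- collected in `P`, from the known row sum of `S`.
      expand : ∀ s a q e → s * (s + a - q * e) ≡ s * (s - + 1) + s + s * a + - q * (s * e)
      expand = solve-∀
      -- Symmetry rewrites column `i` as row `i`, the form in which `P` and `R` are stated.
      AG₁-row : ∀ k → (A ⊛ G₁) k i ≡ S i k + A i k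
      AG₁-row k = trans (⊛-distribˡ-⊕ A A idMat k i)
        (cong₂ _+_ (S-sym k i) (trans (⊛-identityʳ A k i) (adjMat-sym Γ k i)))
      SG₂ : (S ⊛ G₂) i i ≡ P + + suc q * + suc q + R + - + q * + suc q
      SG₂ = begin
        sumFin n (λ k → S i k * ((A ⊛ G₁) k i - + q * idMat k i))
          ≡⟨ sumFin-cong (λ k → trans (cong (λ x → S i k * (x - + q * idMat k i)) (AG₁-row k))
                                      (expand (S i k) (A i k) (+ q) (idMat k i))) ⟩
        sumFin n (λ k → S i k * (S i k - + 1) + S i k + S i k * A i k + - + q * (S i k * idMat k i))
          ≡⟨ sumFin-linear (- + q) (λ k → S i k * (S i k - + 1) + S i k + S i k * A i k) (λ k → S i k * idMat k i) ⟩
        sumFin n (λ k → S i k * (S i k - + 1) + S i k + S i k * A i k) + - + q * (S ⊛ idMat) i i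
          ≡⟨ cong₂ (λ x y → x + - + q * y)
               (trans (sumFin-+ (λ k → S i k * (S i k - + 1) + S i k) (λ k → S i k * A i k))
                      (cong (_+ R) (trans (sumFin-+ (λ k → S i k * (S i k - + 1)) (S i)) (cong (λ x → P + x) (S-row i)))))
               (trans (⊛-identityʳ S i i) (S-diag i)) ⟩
        P + + suc q * + suc q + R + - + q * + suc q ∎
      finish : ∀ p r q → p + (+ 1 + q) * (+ 1 + q) + r + - q * (+ 1 + q) - q * (+ 1 + q) - q * ((+ 1 + q) - q * + 1)
               ≡ p + r + + 1 - (+ 1 + q) * q
      finish = solve-∀

    -- The diagonal entry 1 forces `P + R` to equal d(d - 1). The terms of `P` at `i` and `k` alone
    -- exceed this by 2, and `R`, the number of closed walks of length three, is nonnegative.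
    no-four-cycle : (∀ i → Gpoly (suc q) 4 A i i ≡ + 1) → ∀ {i k x y} → i ≢ k → x ≢ y →
                    adj Γ i x ≡ true → adj Γ k x ≡ true → adj Γ i y ≡ true → adj Γ k y ≡ true → ⊥
    no-four-cycle diag {i} {k} i≢k x≢y ix kx iy ky = contradiction 2≤0 λ { (+≤+ ()) }
      where
      P = sumFin n (λ k → S i k * (S i k - + 1))
      R = sumFin n (λ k → S i k * A i k)
      R-nonneg : + 0 ≤ R
      R-nonneg = sumFin-nonneg (λ k → SA-nonneg (S-nonneg i k) (adj Γ i k))
        where
        SA-nonneg : ∀ {s} → + 0 ≤ s → ∀ b → + 0 ≤ s * bool→ℤ b
        SA-nonneg {s} 0≤s true  = ≤-trans 0≤s (≤-reflexive (sym (*-identityʳ s)))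
        SA-nonneg {s} 0≤s false = ≤-reflexive (sym (*-zeroʳ s))
      P-bound : + suc q * + q + + 2 ≤ P
      P-bound = ≤-trans
        (+-mono-≤ (≤-reflexive (sym (cong (λ s → s * (s - + 1)) (S-diag i))))
                  (2≤pairs (S i k) (S-two-paths x≢y ix kx iy ky)))
        (two-terms≤sumFin (λ k → pairs-nonneg (S i k) (S-nonneg i k)) i≢k)
      cancel : ∀ p r m → p + r + + 1 - m ≡ + 1 → (m + + 2) + + 0 ≤ p + r → + 2 ≤ + 0
      cancel p r m e h = ≤-trans (≤-reflexive (l m)) (≤-trans (+-monoˡ-≤ (- m) h)
        (≤-reflexive (trans (r′ p r m) (cong (_- + 1) e))))
        where
        l : ∀ m → + 2 ≡ (m + + 2) + + 0 - m
        l = solve-∀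
        r′ : ∀ p r m → p + r - m ≡ p + r + + 1 - m - + 1
        r′ = solve-∀
      2≤0 : + 2 ≤ + 0
      2≤0 = cancel P R (+ suc q * + q) (trans (sym (G₄-diag i)) (diag i)) (+-mono-≤ P-bound R-nonneg)

-- Parity

sgn : ℕ → ℤ
sgn zero    = + 1
sgn (suc m) = - sgn m

-- Carrying parity as a sign turns sums of indices into products in ℤ; the same signs later form the
-- alternating vector.
sgn-+ : ∀ m n → sgn (m ℕ.+ n) ≡ sgn m * sgn n
sgn-+ zero    n = sym (*-identityˡ (sgn n))
sgn-+ (suc m) n = trans (cong -_ (sgn-+ m n)) (neg-distribˡ-* (sgn m) (sgn n))

sgn² : ∀ m → sgn m * sgn m ≡ + 1
sgn² zero    = refl
sgn² (suc m) = trans (neg-square (sgn m)) (sgn² m)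
  where
  neg-square : ∀ x → - x * - x ≡ x * x
  neg-square = solve-∀

sgn-double : ∀ m → sgn (m ℕ.+ m) ≡ + 1
sgn-double m = trans (sgn-+ m m) (sgn² m)

-- A sign is its own inverse, so the sign of one summand can be divided out of the sign of a sum.
sgn-summand : ∀ m n → sgn n ≡ sgn m * sgn (m ℕ.+ n)
sgn-summand m n = begin
  sgn n                    ≡⟨ *-identityˡ (sgn n) ⟨
  + 1 * sgn n              ≡⟨ cong (_* sgn n) (sgn² m) ⟨
  sgn m * sgn m * sgn n    ≡⟨ *-assoc (sgn m) (sgn m) (sgn n) ⟩
  sgn m * (sgn m * sgn n)  ≡⟨ cong (sgn m *_) (sgn-+ m n) ⟨
  sgn m * sgn (m ℕ.+ n)    ∎

data Parity (m : ℕ) : Set where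
  even : sgn m ≡ + 1 → Parity m
  odd  : sgn m ≡ -1ℤ → Parity m

parity : ∀ m → Parity m
parity zero = even refl
parity (suc m) with parity m
... | even e = odd (cong -_ e)
... | odd e  = even (cong -_ e)

half : ∀ m → sgn m ≡ + 1 → ∃ λ k → m ≡ k ℕ.+ k
half zero          _ = 0 , refl
half (suc zero)    ()
half (suc (suc m)) e with half m (trans (sym (neg-involutive (sgn m))) e)
... | k , refl = suc k , cong suc (sym (ℕ.+-suc k k))

sgn-* : ∀ m n → sgn n ≡ + 1 → sgn (m ℕ.* n) ≡ + 1
sgn-* zero    n _ = refl
sgn-* (suc m) n e = trans (sgn-+ n (m ℕ.* n)) (cong₂ _*_ e (sgn-* m n e))

-- One term of a 0-1 matrix row applied to the alternating vector, used for both the graph and the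
-- cycle: an edge joins opposite signs, and a non-edge contributes zero to both sides.
alternating-row : ∀ b k i → (T b → sgn k ≡ - sgn i) → bool→ℤ b * sgn k ≡ (- sgn i) * bool→ℤ b
alternating-row true  k i h = trans (*-identityˡ (sgn k)) (trans (h _) (sym (*-identityʳ (- sgn i))))
alternating-row false k i h = trans (*-zeroˡ (sgn k)) (sym (*-zeroʳ (- sgn i)))

-- Consecutive signs cancel in pairs; the offset `a` lets the induction drop the first two terms.
sumFin-alternating : ∀ k a → sumFin (k ℕ.+ k) (λ i → sgn (a ℕ.+ toℕ i)) ≡ + 0
sumFin-alternating zero    a = refl
sumFin-alternating (suc k) a rewrite ℕ.+-suc k k = begin
  sgn (a ℕ.+ 0) + (sgn (a ℕ.+ 1) + sumFin (k ℕ.+ k) (λ i → sgn (a ℕ.+ suc (suc (toℕ i)))))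
    ≡⟨ cong₂ (λ x y → x + (y + sumFin (k ℕ.+ k) (λ i → sgn (a ℕ.+ suc (suc (toℕ i)))))) (cong sgn (ℕ.+-identityʳ a)) (cong sgn (ℕ.+-comm a 1)) ⟩
  sgn a + (- sgn a + sumFin (k ℕ.+ k) (λ i → sgn (a ℕ.+ suc (suc (toℕ i)))))
    ≡⟨ cong (λ x → sgn a + (- sgn a + x))
         (trans (sumFin-cong {k ℕ.+ k} (λ i → cong sgn (trans (ℕ.+-suc a (suc (toℕ i))) (cong suc (ℕ.+-suc a (toℕ i))))))
                (sumFin-alternating k (suc (suc a)))) ⟩
  sgn a + (- sgn a + + 0)
    ≡⟨ cong (λ x → sgn a + x) (+-identityʳ (- sgn a)) ⟩
  sgn a + - sgn a
    ≡⟨ +-inverseʳ (sgn a) ⟩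
  + 0 ∎

-- Cyclic indexing

module _ {n} .{{_ : NonZero n}} where

  idx : ℕ → Fin n
  idx m = m mod n

  toℕ-idx : ∀ m → toℕ (idx m) ≡ m % n
  toℕ-idx m = Fin.toℕ-fromℕ< (m%n<n m n)

  idx-period : ∀ m k → idx (m ℕ.+ k ℕ.* n) ≡ idx m
  idx-period m k = Fin.toℕ-injective (trans (toℕ-idx (m ℕ.+ k ℕ.* n)) (trans ([m+kn]%n≡m%n m k n) (sym (toℕ-idx m))))

  idx-+n : ∀ m → idx (m ℕ.+ n) ≡ idx m
  idx-+n m = trans (cong (idx ∘ (m ℕ.+_)) (sym (ℕ.+-identityʳ n))) (idx-period m 1)

  idx-toℕ : ∀ i → idx (toℕ i) ≡ i
  idx-toℕ i = Fin.toℕ-injective (trans (toℕ-idx (toℕ i)) (m<n⇒m%n≡m (Fin.toℕ<n i)))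

  -- Addition of indices descends to residues, because `m` and its remainder differ by a multiple of
  -- `n`.
  idx-decompose : ∀ a m → idx (a ℕ.+ m) ≡ idx (a ℕ.+ toℕ (idx m))
  idx-decompose a m = begin
    idx (a ℕ.+ m)                                ≡⟨ cong (λ x → idx (a ℕ.+ x)) (m≡m%n+[m/n]*n m n) ⟩
    idx (a ℕ.+ (m % n ℕ.+ m / n ℕ.* n))          ≡⟨ cong idx (ℕ.+-assoc a (m % n) _) ⟨
    idx (a ℕ.+ m % n ℕ.+ m / n ℕ.* n)            ≡⟨ idx-period (a ℕ.+ m % n) (m / n) ⟩
    idx (a ℕ.+ m % n)                            ≡⟨ cong (λ x → idx (a ℕ.+ x)) (toℕ-idx m) ⟨
    idx (a ℕ.+ toℕ (idx m))                      ∎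

  -- Removing a multiple of an even `n` keeps the sign, so parity becomes a property of the vertex.
  sgn-idx : sgn n ≡ + 1 → ∀ m → sgn (toℕ (idx m)) ≡ sgn m
  sgn-idx n-even m = begin
    sgn (toℕ (idx m))                      ≡⟨ cong sgn (toℕ-idx m) ⟩
    sgn (m % n)                            ≡⟨ *-identityʳ _ ⟨
    sgn (m % n) * + 1                      ≡⟨ cong (sgn (m % n) *_) (sgn-* (m / n) n n-even) ⟨
    sgn (m % n) * sgn (m / n ℕ.* n)        ≡⟨ sgn-+ (m % n) _ ⟨
    sgn (m % n ℕ.+ m / n ℕ.* n)            ≡⟨ cong sgn (m≡m%n+[m/n]*n m n) ⟨
    sgn m                                  ∎

  next : Fin n → Fin n
  next i = idx (suc (toℕ i))

  next-idx : ∀ m → next (idx m) ≡ idx (suc m)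
  next-idx m = sym (idx-decompose 1 m)

  -- After one step along the cycle, `pred n` further steps return to the start.
  next-injective : Injective _≡_ _≡_ next
  next-injective {i} {j} e = begin
    i                      ≡⟨ back i ⟨
    idx (ℕ.pred n ℕ.+ toℕ (next i))  ≡⟨ cong (λ x → idx (ℕ.pred n ℕ.+ toℕ x)) e ⟩
    idx (ℕ.pred n ℕ.+ toℕ (next j))  ≡⟨ back j ⟩
    j                      ∎
    where
    back : ∀ i → idx (ℕ.pred n ℕ.+ toℕ (next i)) ≡ i
    back i = begin
      idx (ℕ.pred n ℕ.+ toℕ (next i))    ≡⟨ idx-decompose (ℕ.pred n) (suc (toℕ i)) ⟨
      idx (ℕ.pred n ℕ.+ suc (toℕ i))     ≡⟨ cong idx (ℕ.+-suc (ℕ.pred n) (toℕ i)) ⟩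
      idx (suc (ℕ.pred n) ℕ.+ toℕ i)     ≡⟨ cong (λ x → idx (x ℕ.+ toℕ i)) (ℕ.suc-pred n) ⟩
      idx (n ℕ.+ toℕ i)                  ≡⟨ cong idx (ℕ.+-comm n (toℕ i)) ⟩
      idx (toℕ i ℕ.+ n)                  ≡⟨ idx-+n (toℕ i) ⟩
      idx (toℕ i)                        ≡⟨ idx-toℕ i ⟩
      i                                  ∎

  toℕ-next : ∀ i → (toℕ (next i) ≡ suc (toℕ i) × suc (toℕ i) ℕ.< n) ⊎ (toℕ (next i) ≡ 0 × suc (toℕ i) ≡ n)
  toℕ-next i with suc (toℕ i) ℕ.<? n
  ... | yes i<n = inj₁ (trans (toℕ-idx _) (m<n⇒m%n≡m i<n) , i<n)
  ... | no  i≮n = inj₂ (trans (toℕ-idx _) (trans (cong (_% n) si≡n) (n%n≡0 n)) , si≡n)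
    where
    si≡n : suc (toℕ i) ≡ n
    si≡n = ℕ.≤-antisym (Fin.toℕ<n i) (ℕ.≮⇒≥ i≮n)

  toℕ-suc⇒next : ∀ i j → toℕ j ≡ suc (toℕ i) → next i ≡ j
  toℕ-suc⇒next i j e with toℕ-next i
  ... | inj₁ (h , _) = Fin.toℕ-injective (trans h (sym e))
  ... | inj₂ (_ , h) = contradiction (trans e h) (ℕ.<⇒≢ (Fin.toℕ<n j))

  toℕ-wrap⇒next : ∀ i j → toℕ j ≡ 0 → toℕ i ≡ n ℕ.∸ 1 → next i ≡ j
  toℕ-wrap⇒next i j j≡0 i≡n-1 with toℕ-next i
  ... | inj₁ (_ , h) = contradiction (trans (cong suc i≡n-1) (ℕ.suc-pred n)) (ℕ.<⇒≢ h)
  ... | inj₂ (h , _) = Fin.toℕ-injective (trans h (sym j≡0))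

  cyclicAdj⇒next : ∀ (i j : Fin n) → T (cyclicAdj i j) → i ≡ next j ⊎ next i ≡ j
  cyclicAdj⇒next i j t with to (T-∨ {toℕ j ℕ.≡ᵇ suc (toℕ i)}) t
  ... | inj₁ p = inj₂ (toℕ-suc⇒next i j (ℕ.≡ᵇ⇒≡ _ _ p))
  ... | inj₂ t′ with to (T-∨ {toℕ i ℕ.≡ᵇ suc (toℕ j)}) t′
  ...   | inj₁ p = inj₁ (sym (toℕ-suc⇒next j i (ℕ.≡ᵇ⇒≡ _ _ p)))
  ...   | inj₂ t″ with to (T-∨ {(toℕ i ℕ.≡ᵇ 0) ∧ (toℕ j ℕ.≡ᵇ (n ℕ.∸ 1))}) t″
  ...     | inj₁ p with to (T-∧ {toℕ i ℕ.≡ᵇ 0}) p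
  ...       | p₁ , p₂ = inj₁ (sym (toℕ-wrap⇒next j i (ℕ.≡ᵇ⇒≡ _ _ p₁) (ℕ.≡ᵇ⇒≡ _ _ p₂)))
  cyclicAdj⇒next i j t | inj₂ t′ | inj₂ t″ | inj₂ p with to (T-∧ {toℕ j ℕ.≡ᵇ 0}) p
  ...       | p₁ , p₂ = inj₂ (toℕ-wrap⇒next i j (ℕ.≡ᵇ⇒≡ _ _ p₁) (ℕ.≡ᵇ⇒≡ _ _ p₂))

  next⇒cyclicAdj : ∀ i → T (cyclicAdj i (next i)) × T (cyclicAdj (next i) i)
  next⇒cyclicAdj i with next i | toℕ-next i
  ... | j | inj₁ (h , _) =
      from (T-∨ {toℕ j ℕ.≡ᵇ suc (toℕ i)}) (inj₁ (ℕ.≡⇒≡ᵇ _ _ h))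
    , from (T-∨ {toℕ i ℕ.≡ᵇ suc (toℕ j)}) (inj₂
        (from (T-∨ {toℕ j ℕ.≡ᵇ suc (toℕ i)}) (inj₁ (ℕ.≡⇒≡ᵇ _ _ h))))
  ... | j | inj₂ (h , si≡n) =
      from (T-∨ {toℕ j ℕ.≡ᵇ suc (toℕ i)}) (inj₂
        (from (T-∨ {toℕ i ℕ.≡ᵇ suc (toℕ j)}) (inj₂
          (from (T-∨ {(toℕ i ℕ.≡ᵇ 0) ∧ (toℕ j ℕ.≡ᵇ (n ℕ.∸ 1))}) (inj₂ wrap)))))
    , from (T-∨ {toℕ i ℕ.≡ᵇ suc (toℕ j)}) (inj₂
        (from (T-∨ {toℕ j ℕ.≡ᵇ suc (toℕ i)}) (inj₂
          (from (T-∨ {(toℕ j ℕ.≡ᵇ 0) ∧ (toℕ i ℕ.≡ᵇ (n ℕ.∸ 1))}) (inj₁ wrap)))))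
    where
    wrap : T ((toℕ j ℕ.≡ᵇ 0) ∧ (toℕ i ℕ.≡ᵇ (n ℕ.∸ 1)))
    wrap = from (T-∧ {toℕ j ℕ.≡ᵇ 0}) (ℕ.≡⇒≡ᵇ _ _ h , ℕ.≡⇒≡ᵇ _ _ (cong ℕ.pred si≡n))

  cyclicAdj-sym : ∀ (i j : Fin n) → T (cyclicAdj i j) → T (cyclicAdj j i)
  cyclicAdj-sym i j t with cyclicAdj⇒next i j t
  ... | inj₁ refl = proj₁ (next⇒cyclicAdj j)
  ... | inj₂ refl = proj₂ (next⇒cyclicAdj i)

  -- Without a wrap the value would have to equal itself plus 2; a single wrap forces n = 2, and two
  -- wraps force n = 1.
  next-next≢ : 3 ℕ.≤ n → ∀ i → next (next i) ≢ i
  next-next≢ 3≤n i e with toℕ-next i | toℕ-next (next i)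
  ... | inj₁ (h , _) | inj₁ (h′ , _) = ℕ.m≢1+n+m (toℕ i) {1} (trans (sym (cong toℕ e)) (trans h′ (cong suc h)))
  ... | inj₁ (h , _) | inj₂ (h′ , n≡) = contradiction 3≤n (ℕ.<⇒≱ (ℕ.≤-reflexive (cong suc
        (trans (sym n≡) (cong suc (trans h (cong suc (trans (sym (cong toℕ e)) h′))))))))
  ... | inj₂ (h , n≡) | inj₁ (h′ , _) = contradiction 3≤n (ℕ.<⇒≱ (ℕ.≤-reflexive (cong suc
        (trans (sym n≡) (cong suc (trans (sym (cong toℕ e)) (trans h′ (cong suc h))))))))
  ... | inj₂ (h , n≡) | inj₂ (_ , n≡′) = contradiction 3≤n (ℕ.<⇒≱ (ℕ.≤-trans (ℕ.≤-reflexive (cong suc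
        (trans (sym n≡′) (cong suc h)))) (ℕ.s≤s (ℕ.s≤s ℕ.z≤n))))

  -- The column is written `idx (suc m)` so that both of its neighbours can be named without a
  -- predecessor. As `n` is at least 3 they are distinct, and the two indicators never overlap.
  cyclicAdj-split : 3 ℕ.≤ n → ∀ k (m : ℕ) →
                    bool→ℤ (cyclicAdj k (idx (suc m))) ≡ idMat k (idx (suc (suc m))) + idMat k (idx m)
  cyclicAdj-split 3≤n k m = bool→ℤ-⊎ {cyclicAdj k j} {k == idx (suc (suc m))} {k == idx m} split
    (λ t → subst (λ k → T (cyclicAdj k j)) (trans (next-idx (suc m)) (sym (==⇒≡ k _ t))) (proj₂ (next⇒cyclicAdj j)))
    (λ t → subst (λ l → T (cyclicAdj l j)) (sym (==⇒≡ k _ t))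
             (subst (λ l → T (cyclicAdj (idx m) l)) (next-idx m) (proj₁ (next⇒cyclicAdj (idx m)))))
    (λ { (s , t) → next-next≢ 3≤n (idx m) (trans (cong next (next-idx m))
        (trans (next-idx (suc m)) (trans (sym (==⇒≡ k _ s)) (==⇒≡ k _ t)))) })
    where
    j = idx (suc m)
    split : T (cyclicAdj k j) → T (k == idx (suc (suc m))) ⊎ T (k == idx m)
    split t with cyclicAdj⇒next k j t
    ... | inj₁ e = inj₁ (≡⇒== k _ (trans e (next-idx (suc m))))
    ... | inj₂ e = inj₂ (≡⇒== k _ (next-injective (trans e (sym (next-idx m)))))

  sumFin-cyclicAdj : 3 ℕ.≤ n → ∀ (f : Fin n → ℤ) m →
                     sumFin n (λ k → f k * bool→ℤ (cyclicAdj k (idx (suc m)))) ≡ f (idx (suc (suc m))) + f (idx m)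
  sumFin-cyclicAdj 3≤n f m = begin
    sumFin n (λ k → f k * bool→ℤ (cyclicAdj k (idx (suc m))))
      ≡⟨ sumFin-cong (λ k → trans (cong (f k *_) (cyclicAdj-split 3≤n k m)) (*-distribˡ-+ (f k) _ _)) ⟩
    sumFin n (λ k → f k * idMat k (idx (suc (suc m))) + f k * idMat k (idx m))
      ≡⟨ sumFin-+ (λ k → f k * idMat k (idx (suc (suc m)))) (λ k → f k * idMat k (idx m)) ⟩
    sumFin n (λ k → f k * idMat k (idx (suc (suc m)))) + sumFin n (λ k → f k * idMat k (idx m))
      ≡⟨ cong₂ _+_ (sumFin-idMat f (idx (suc (suc m)))) (sumFin-idMat f (idx m)) ⟩
    f (idx (suc (suc m))) + f (idx m) ∎

-- Integer arithmetic: differences, units, the value of G₄ at -d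

balance : ∀ a b c d → b + c ≡ a + d → a - b ≡ c - d
balance a b c d e = begin
  a - b              ≡⟨ left a b d ⟩
  (a + d) - (b + d)  ≡⟨ cong (_- (b + d)) e ⟨
  (b + c) - (b + d)  ≡⟨ right b c d ⟩
  c - d              ∎
  where
  left : ∀ a b d → a - b ≡ (a + d) - (b + d)
  left = solve-∀
  right : ∀ b c d → (b + c) - (b + d) ≡ c - d
  right = solve-∀

IsUnit : ℤ → Set
IsUnit ε = ε ≡ + 1 ⊎ ε ≡ -1ℤ

unit-cancel : ∀ {ε a b} → IsUnit ε → ε * a ≡ ε * b → a ≡ b
unit-cancel (inj₁ refl) = *-cancelˡ-≡ (+ 1) _ _
unit-cancel (inj₂ refl) = *-cancelˡ-≡ -1ℤ _ _

-- The right-hand side is the fourth power of q = e + 2, in Horner form. Over ℕ this form shows at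
-- once that the value is at least 16.
Geval-neg-degree : ∀ {q} → 2 ℕ.≤ q → let e = q ℕ.∸ 2 in
  Geval (suc q) 4 (- (+ suc q)) ≡ + (16 ℕ.+ e ℕ.* (32 ℕ.+ e ℕ.* (24 ℕ.+ e ℕ.* (8 ℕ.+ e))))
Geval-neg-degree {suc zero} (ℕ.s≤s ())
Geval-neg-degree {suc (suc e)} _ = begin
  Geval (3 ℕ.+ e) 4 (- (+ (3 ℕ.+ e)))
    ≡⟨ polynomial (+ e) ⟩
  + 16 + + e * (+ 32 + + e * (+ 24 + + e * (+ 8 + + e)))
    ≡⟨ cong (λ x → + 16 + + e * (+ 32 + + e * (+ 24 + x))) (pos-* e (8 ℕ.+ e)) ⟨
  + 16 + + e * (+ 32 + + e * + (24 ℕ.+ e ℕ.* (8 ℕ.+ e)))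
    ≡⟨ cong (λ x → + 16 + + e * (+ 32 + x)) (pos-* e _) ⟨
  + 16 + + e * + (32 ℕ.+ e ℕ.* (24 ℕ.+ e ℕ.* (8 ℕ.+ e)))
    ≡⟨ cong (λ x → + 16 + x) (pos-* e _) ⟨
  + (16 ℕ.+ e ℕ.* (32 ℕ.+ e ℕ.* (24 ℕ.+ e ℕ.* (8 ℕ.+ e)))) ∎
  where
  polynomial : ∀ e → let x = - (+ 3 + e); q = + 2 + e in
    x * (x * (x * (x + + 1) - q * + 1) - q * (x + + 1)) - q * (x * (x + + 1) - q * + 1)
    ≡ + 16 + e * (+ 32 + e * (+ 24 + e * (+ 8 + e)))
  polynomial = solve-∀

-- The wave equation for the adjacency entries

module _ {n q} .{{_ : NonZero n}} (3≤n : 3 ℕ.≤ n) (Γ : Graph n) (reg : IsRegular Γ (suc q)) where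

  private
    A C : Mat n
    A = adjMat Γ
    C i j = bool→ℤ (cyclicAdj i j)

  u : ℕ → ℕ → Bool
  u i j = adj Γ (idx i) (idx j)

  u-sym : ∀ i j → u i j ≡ u j i
  u-sym i j = symm Γ (idx i) (idx j)

  u-diag : ∀ i → u i i ≡ false
  u-diag i = irrefl Γ (idx i)

  u-period : ∀ i j k l → u (i ℕ.+ k ℕ.* n) (j ℕ.+ l ℕ.* n) ≡ u i j
  u-period i j k l = cong₂ (adj Γ) (idx-period i k) (idx-period j l)

  C-sym : ∀ i j → C i j ≡ C j i
  C-sym i j = bool→ℤ-cong {cyclicAdj i j} {cyclicAdj j i} (cyclicAdj-sym i j) (cyclicAdj-sym j i)

  AC : ∀ i j → (A ⊛ C) (idx i) (idx (suc j)) ≡ bool→ℤ (u i (suc (suc j))) + bool→ℤ (u i j)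
  AC i j = sumFin-cyclicAdj 3≤n (A (idx i)) j

  CA : ∀ i j → (C ⊛ A) (idx (suc i)) (idx j) ≡ bool→ℤ (u (suc (suc i)) j) + bool→ℤ (u i j)
  CA i j = trans (sumFin-cong (λ k → trans (*-comm (C (idx (suc i)) k) (A k (idx j)))
                   (cong (A k (idx j) *_) (C-sym (idx (suc i)) k))))
                 (sumFin-cyclicAdj 3≤n (λ k → A k (idx j)) i)

  module _ {ε} (unit : IsUnit ε)
           (G₄ : ∀ i j → Gpoly (suc q) 4 (adjMat Γ) i j ≡ + 1 + ε * bool→ℤ (cyclicAdj i j)) where

    -- By regularity and symmetry, the all-ones part contributes d to every entry of both products
    -- with `A`. Cancelling d and then the unit `ε` leaves the cycle part.
    C-commutes : ∀ i j → (A ⊛ C) i j ≡ (C ⊛ A) i j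
    C-commutes i j = unit-cancel unit (∙-cancelˡ +-0-abelianGroup (+ suc q) _ _ (begin
      + suc q + ε * (A ⊛ C) i j
        ≡⟨ cong (_+ ε * (A ⊛ C) i j) (reg i) ⟨
      sumFin n (A i) + ε * (A ⊛ C) i j
        ≡⟨ sumFin-linear ε (A i) (λ k → A i k * C k j) ⟨
      sumFin n (λ k → A i k + ε * (A i k * C k j))
        ≡⟨ sumFin-cong (λ k → trans (sym (expandˡ ε (A i k) (C k j))) (cong (A i k *_) (sym (G₄ k j)))) ⟩
      (A ⊛ Gpoly (suc q) 4 A) i j
        ≡⟨ Gpoly-commutes A (suc q) 4 i j ⟩
      (Gpoly (suc q) 4 A ⊛ A) i j
        ≡⟨ sumFin-cong (λ k → trans (cong (_* A k j) (G₄ i k)) (trans (expandʳ ε (A k j) (C i k))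
             (cong (_+ ε * (C i k * A k j)) (adjMat-sym Γ k j)))) ⟩
      sumFin n (λ k → A j k + ε * (C i k * A k j))
        ≡⟨ sumFin-linear ε (A j) (λ k → C i k * A k j) ⟩
      sumFin n (A j) + ε * (C ⊛ A) i j
        ≡⟨ cong (_+ ε * (C ⊛ A) i j) (reg j) ⟩
      + suc q + ε * (C ⊛ A) i j ∎))
      where
      expandˡ : ∀ ε a c → a * (+ 1 + ε * c) ≡ a + ε * (a * c)
      expandˡ = solve-∀
      expandʳ : ∀ ε a c → (+ 1 + ε * c) * a ≡ a + ε * (c * a)
      expandʳ = solve-∀

    -- The commutation relation at row i + 1 and column j + 1: a cycle factor on the right shifts
    -- the second index by one either way, a cycle factor on the left the first.
    wave : ∀ i j → bool→ℤ (u (suc i) (suc (suc j))) + bool→ℤ (u (suc i) j) ≡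
                   bool→ℤ (u (suc (suc i)) (suc j)) + bool→ℤ (u i (suc j))
    wave i j = trans (sym (AC (suc i) j)) (trans (C-commutes (idx (suc i)) (idx (suc j))) (CA i (suc j)))

    Δ : ℕ → ℕ → ℤ
    Δ i j = bool→ℤ (u (suc i) (suc j)) - bool→ℤ (u i j)

    -- This is the wave equation regrouped into differences along a line of constant i - j. It makes
    -- `Δ` a function of i + j alone.
    Δ-slide : ∀ i j → Δ (suc i) j ≡ Δ i (suc j)
    Δ-slide i j = balance (bool→ℤ (u (suc (suc i)) (suc j))) (bool→ℤ (u (suc i) j))
                          (bool→ℤ (u (suc i) (suc (suc j)))) (bool→ℤ (u i (suc j)))
                          (trans (+-comm (bool→ℤ (u (suc i) j)) _) (wave i j))

    Δ-sum : ∀ i j → Δ i j ≡ Δ 0 (i ℕ.+ j)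
    Δ-sum zero    j = refl
    Δ-sum (suc i) j = trans (Δ-slide i j) (trans (Δ-sum i (suc j)) (cong (Δ 0) (ℕ.+-suc i j)))

    -- An even `m` is the index sum of a diagonal position (k, k), and the diagonal of the adjacency
    -- matrix is zero.
    Δ-even : ∀ m → sgn m ≡ + 1 → Δ 0 m ≡ + 0
    Δ-even m e with half m e
    ... | k , refl = trans (sym (Δ-sum k k))
            (cong₂ (λ x y → bool→ℤ x - bool→ℤ y) (u-diag (suc k)) (u-diag k))

    Δ-period : ∀ m k → Δ 0 (m ℕ.+ k ℕ.* n) ≡ Δ 0 m
    Δ-period m k = cong₂ (λ x y → bool→ℤ x - bool→ℤ y) (u-period 1 (suc m) 0 k) (u-period 0 m 0 k)

    translate : ∀ i j → Δ 0 (i ℕ.+ j) ≡ + 0 → u (suc i) (suc j) ≡ u i j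
    translate i j e = bool→ℤ-injective (i-j≡0⇒i≡j (bool→ℤ (u (suc i) (suc j))) _ (trans (Δ-sum i j) e))

    -- The step numbered `l` of the translation meets `Δ` at index sum i + j + 2l, hence the form of
    -- the hypothesis. If i + j is even, only even arguments occur.
    translate* : ∀ k i j → (∀ l → Δ 0 (l ℕ.+ l ℕ.+ (i ℕ.+ j)) ≡ + 0) → u (k ℕ.+ i) (k ℕ.+ j) ≡ u i j
    translate* zero    i j null = refl
    translate* (suc k) i j null =
      trans (translate (k ℕ.+ i) (k ℕ.+ j) (trans (cong (Δ 0) (rearrange k i j)) (null k))) (translate* k i j null)
      where
      rearrange : ∀ k i j → k ℕ.+ i ℕ.+ (k ℕ.+ j) ≡ k ℕ.+ k ℕ.+ (i ℕ.+ j)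
      rearrange = ℕ-solve-∀

    translate-even : ∀ k i j → sgn (i ℕ.+ j) ≡ + 1 → u (k ℕ.+ i) (k ℕ.+ j) ≡ u i j
    translate-even k i j e = translate* k i j (λ l → Δ-even (l ℕ.+ l ℕ.+ (i ℕ.+ j))
      (trans (sgn-+ (l ℕ.+ l) (i ℕ.+ j)) (cong₂ _*_ (sgn-double l) e)))

    -- A representative of -m modulo `n` that avoids subtraction.
    opp : ℕ → ℕ
    opp m = ℕ.pred n ℕ.* m

    +-opp : ∀ m → m ℕ.+ opp m ≡ m ℕ.* n
    +-opp m = trans (cong (ℕ._* m) (ℕ.suc-pred n)) (ℕ.*-comm n m)

    -- The cycle matrix has zero diagonal, so G₄(A) has diagonal 1 as `no-four-cycle` demands.
    no-C₄ : ∀ {i k x y} → idx i ≢ idx k → idx x ≢ idx y →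
            u i x ≡ true → u k x ≡ true → u i y ≡ true → u k y ≡ true → ⊥
    no-C₄ = no-four-cycle Γ reg (λ i → trans (G₄ i i)
              (trans (cong (λ x → + 1 + ε * x) (C-irrefl i)) (cong (λ x → + 1 + x) (*-zeroʳ ε))))
      where
      C-irrefl : ∀ (i : Fin n) → C i i ≡ + 0
      C-irrefl i = bool→ℤ-cong {cyclicAdj i i} {false} (λ t → [ next≢ i ∘ sym , next≢ i ]′ (cyclicAdj⇒next i i t)) ⊥-elim
        where
        next≢ : ∀ i → next i ≢ i
        next≢ i e = next-next≢ 3≤n i (trans (cong next e) e)

    -- The four-cycle is 0, x, x + y, y. The inequalities keep opposite corners apart, and the last
    -- two hypotheses have the form in which translation supplies them.
    no-parallelogram : ∀ {x y} → idx x ≢ idx y → idx (x ℕ.+ y) ≢ idx 0 → u 0 x ≡ true → u 0 y ≡ true →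
                       u (x ℕ.+ 0) (x ℕ.+ y) ≡ u 0 y → u (y ℕ.+ 0) (y ℕ.+ x) ≡ u 0 x → ⊥
    no-parallelogram {x} {y} x≢y x+y≢0 0x 0y xy yx rewrite ℕ.+-identityʳ x | ℕ.+-identityʳ y | ℕ.+-comm y x =
      no-C₄ {0} {x ℕ.+ y} (x+y≢0 ∘ sym) x≢y 0x (trans (u-sym (x ℕ.+ y) x) (trans xy 0y))
                          0y (trans (u-sym (x ℕ.+ y) y) (trans yx 0x))

    -- Excluding circulant graphs

    module _ (2≤q : 2 ℕ.≤ q) where

      -- The second neighbour is chosen to avoid `x` and -x, which makes the parallelogram on 0, x,
      -- x + y, y nondegenerate.
      two-neighbours : ∃ λ x → ∃ λ y → u 0 x ≡ true × u 0 y ≡ true × idx x ≢ idx y × idx (x ℕ.+ y) ≢ idx 0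
      two-neighbours
        with pick ← true-outside-pair (adj Γ (idx 0)) (≤-trans (+≤+ (ℕ.s≤s 2≤q)) (≤-reflexive (sym (reg (idx 0)))))
        with x , 0x , _ ← pick (idx 0) (idx 0)
        with y , 0y , y≢x , y≢-x ← pick x (idx (opp (toℕ x)))
        = toℕ x , toℕ y
        , trans (cong (adj Γ (idx 0)) (idx-toℕ x)) 0x
        , trans (cong (adj Γ (idx 0)) (idx-toℕ y)) 0y
        , (λ e → y≢x (trans (sym (idx-toℕ y)) (trans (sym e) (idx-toℕ x))))
        -- If x + y vanished modulo `n`, adding `opp` of `x` would give y = -x.
        , (λ e → y≢-x (begin
            y                                             ≡⟨ idx-toℕ y ⟨
            idx (toℕ y)                                   ≡⟨ idx-period (toℕ y) (toℕ x) ⟨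
            idx (toℕ y ℕ.+ toℕ x ℕ.* n)                   ≡⟨ cong (λ m → idx (toℕ y ℕ.+ m)) (+-opp (toℕ x)) ⟨
            idx (toℕ y ℕ.+ (toℕ x ℕ.+ opp (toℕ x)))       ≡⟨ cong idx (rearrange (toℕ x) (toℕ y) (opp (toℕ x))) ⟩
            idx (opp (toℕ x) ℕ.+ (toℕ x ℕ.+ toℕ y))       ≡⟨ idx-decompose (opp (toℕ x)) (toℕ x ℕ.+ toℕ y) ⟩
            idx (opp (toℕ x) ℕ.+ toℕ (idx (toℕ x ℕ.+ toℕ y))) ≡⟨ cong (λ i → idx (opp (toℕ x) ℕ.+ toℕ i)) e ⟩
            idx (opp (toℕ x) ℕ.+ toℕ (idx 0))             ≡⟨ idx-decompose (opp (toℕ x)) 0 ⟨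
            idx (opp (toℕ x) ℕ.+ 0)                       ≡⟨ cong idx (ℕ.+-identityʳ (opp (toℕ x))) ⟩
            idx (opp (toℕ x))                             ∎))
        where
        rearrange : ∀ x y z → y ℕ.+ (x ℕ.+ z) ≡ z ℕ.+ (x ℕ.+ y)
        rearrange = ℕ-solve-∀

      -- If `Δ` vanishes everywhere, all translations along the cycle preserve adjacency, and any
      -- two suitable neighbours of 0 span a forbidden parallelogram.
      not-circulant : ¬ (∀ m → Δ 0 m ≡ + 0)
      not-circulant null with x , y , 0x , 0y , x≢y , x+y≢0 ← two-neighbours =
        no-parallelogram x≢y x+y≢0 0x 0y (translate* x 0 y (λ l → null _)) (translate* y 0 x (λ l → null _))

      -- The non-circulant case: translation on even sums, reflection on odd sums

      module _ {t} (Δt≢0 : Δ 0 t ≢ + 0) where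

        t-odd : sgn t ≡ -1ℤ
        t-odd with parity t
        ... | even e = contradiction (Δ-even t e) Δt≢0
        ... | odd  e = e

        -- For odd `n` the number t + n would be even, so `Δ` would vanish there; by periodicity it
        -- has the same value as at `t`.
        n-even : sgn n ≡ + 1
        n-even with parity n
        ... | even e = e
        ... | odd  e = contradiction (trans (sym (Δ-period t 1)) (Δ-even (t ℕ.+ 1 ℕ.* n)
                (trans (sgn-+ t (1 ℕ.* n)) (cong₂ _*_ t-odd (trans (cong sgn (ℕ.*-identityˡ n)) e))))) Δt≢0

        ∇ : ℕ → ℕ → ℤ
        ∇ i j = bool→ℤ (u (suc i) j) - bool→ℤ (u i (suc j))

        -- The other grouping of the wave equation: differences along a line of constant i + j are
        -- unchanged when both indices grow by one.
        ∇-translate : ∀ k i j → ∇ (k ℕ.+ i) (k ℕ.+ j) ≡ ∇ i j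
        ∇-translate zero    i j = refl
        ∇-translate (suc k) i j = trans (step (k ℕ.+ i) (k ℕ.+ j)) (∇-translate k i j)
          where
          step : ∀ i j → ∇ (suc i) (suc j) ≡ ∇ i j
          step i j = balance (bool→ℤ (u (suc (suc i)) (suc j))) (bool→ℤ (u (suc i) (suc (suc j))))
                             (bool→ℤ (u (suc i) j)) (bool→ℤ (u i (suc j))) (wave i j)

        even-remainder : ∀ {s} → sgn s ≡ -1ℤ → ∀ r → s ℕ.+ r ≡ t ℕ.+ s ℕ.* n → sgn r ≡ + 1
        even-remainder {s} s-odd r e = begin
          sgn r                            ≡⟨ sgn-summand s r ⟩
          sgn s * sgn (s ℕ.+ r)            ≡⟨ cong₂ _*_ s-odd (trans (cong sgn e) (sgn-+ t (s ℕ.* n))) ⟩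
          -1ℤ * (sgn t * sgn (s ℕ.* n))
            ≡⟨ cong (-1ℤ *_) (cong₂ _*_ t-odd (sgn-* s n n-even)) ⟩
          + 1                              ∎

        -- Translate by (k, k) until i + j + 2k + 1 is congruent to `t` modulo `n`. There `Δ-slide`
        -- equates two nonzero differences of bits, so the bits they start from agree. These are the
        -- two bits compared by `∇`, which the translation does not change.
        reflect : ∀ i j → sgn (i ℕ.+ j) ≡ + 1 → u (suc i) j ≡ u i (suc j)
        reflect i j i+j-even
          -- With s = i + j + 1, adding the multiple s n of the period to `t` leaves room for a
          -- natural number `r` such that s + r = t + s n. It is even, since s and `t` are odd and
          -- `n` is even.
          with r , r≡ ← ℕ.m≤n⇒∃[o]m+o≡n {suc (i ℕ.+ j)} {t ℕ.+ suc (i ℕ.+ j) ℕ.* n}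
                          (ℕ.≤-trans (ℕ.m≤m*n (suc (i ℕ.+ j)) n) (ℕ.m≤n+m _ t))
          with k , refl ← half r (even-remainder (cong -_ i+j-even) r r≡)
          = bool→ℤ-injective (i-j≡0⇒i≡j (bool→ℤ (u (suc i) j)) _ (trans (sym (∇-translate k i j))
              (i≡j⇒i-j≡0 {bool→ℤ (u (suc (k ℕ.+ i)) (k ℕ.+ j))} {bool→ℤ (u (k ℕ.+ i) (suc (k ℕ.+ j)))} (cong bool→ℤ
                (bits-determined {a′ = u (suc (suc (k ℕ.+ i))) (suc (k ℕ.+ j))}
                                 {b′ = u (suc (k ℕ.+ i)) (suc (suc (k ℕ.+ j)))}
                  (λ e → Δt≢0 (trans (sym (Δ≡ {k} r≡)) (trans (sym (Δ-sum (suc (k ℕ.+ i)) (k ℕ.+ j))) e)))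
                  (Δ-slide (k ℕ.+ i) (k ℕ.+ j)))))))
          where
          s = suc (i ℕ.+ j)
          rearrange : ∀ k i j → suc (k ℕ.+ i) ℕ.+ (k ℕ.+ j) ≡ suc (i ℕ.+ j) ℕ.+ (k ℕ.+ k)
          rearrange = ℕ-solve-∀
          Δ≡ : ∀ {k} → s ℕ.+ (k ℕ.+ k) ≡ t ℕ.+ s ℕ.* n → Δ 0 (suc (k ℕ.+ i) ℕ.+ (k ℕ.+ j)) ≡ Δ 0 t
          Δ≡ {k} e = trans (cong (Δ 0) (trans (rearrange k i j) e)) (Δ-period t s)

        -- Units move one at a time from the first index to the second, each move being an instance
        -- of `reflect`.
        reflect-odd : ∀ i j → sgn (i ℕ.+ j) ≡ -1ℤ → u i j ≡ u 0 (i ℕ.+ j)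
        reflect-odd zero    j e = refl
        reflect-odd (suc i) j e = begin
          u (suc i) j            ≡⟨ reflect i j (neg-injective e) ⟩
          u i (suc j)            ≡⟨ reflect-odd i (suc j) (trans (cong sgn (ℕ.+-suc i j)) e) ⟩
          u 0 (i ℕ.+ suc j)      ≡⟨ cong (u 0) (ℕ.+-suc i j) ⟩
          u 0 (suc i ℕ.+ j)      ∎

        -- Put k = a - c. The four-cycle is 0, c, k, a: the pair (k, c) has odd sum a and reflects
        -- to (0, a), while (k, a) translates first to (-c, 0) and then to (0, c). Parity separates
        -- k from 0 and c from a.
        not-both-parities : ∀ {a c} → sgn a ≡ -1ℤ → sgn c ≡ + 1 → u 0 a ≡ true → u 0 c ≡ true → ⊥
        not-both-parities {a} {c} a-odd c-even 0a 0c =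
          no-C₄ {0} {a ℕ.+ opp c} {c} {a}
            (λ e → contradiction (trans (sym (sgn-idx n-even 0)) (trans (cong (sgn ∘ toℕ) e)
                     (trans (sgn-idx n-even (a ℕ.+ opp c)) k-odd))) λ ())
            (λ e → contradiction (trans (sym c-even) (trans (sym (sgn-idx n-even c)) (trans (cong (sgn ∘ toℕ) e)
                     (trans (sgn-idx n-even a) a-odd)))) λ ())
            0c kc 0a ka
          where
          opp-even : sgn (opp c) ≡ + 1
          opp-even = sgn-* (ℕ.pred n) c c-even
          k-odd : sgn (a ℕ.+ opp c) ≡ -1ℤ
          k-odd = trans (sgn-+ a (opp c)) (cong₂ _*_ a-odd opp-even)
          k+c : a ℕ.+ opp c ℕ.+ c ≡ a ℕ.+ c ℕ.* n
          k+c = trans (ℕ.+-assoc a (opp c) c) (cong (a ℕ.+_) (trans (ℕ.+-comm (opp c) c) (+-opp c)))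
          kc : u (a ℕ.+ opp c) c ≡ true
          kc = begin
            u (a ℕ.+ opp c) c          ≡⟨ reflect-odd (a ℕ.+ opp c) c (trans (sgn-+ (a ℕ.+ opp c) c) (cong₂ _*_ k-odd c-even)) ⟩
            u 0 (a ℕ.+ opp c ℕ.+ c)    ≡⟨ cong (u 0) k+c ⟩
            u 0 (a ℕ.+ c ℕ.* n)        ≡⟨ u-period 0 a 0 c ⟩
            u 0 a                      ≡⟨ 0a ⟩
            true                       ∎
          opp+0-even : sgn (opp c ℕ.+ 0) ≡ + 1
          opp+0-even = trans (cong sgn (ℕ.+-identityʳ (opp c))) opp-even
          ka : u (a ℕ.+ opp c) a ≡ true
          ka = begin
            u (a ℕ.+ opp c) a            ≡⟨ cong (u (a ℕ.+ opp c)) (ℕ.+-identityʳ a) ⟨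
            u (a ℕ.+ opp c) (a ℕ.+ 0)    ≡⟨ translate-even a (opp c) 0 opp+0-even ⟩
            u (opp c) 0                  ≡⟨ translate-even c (opp c) 0 opp+0-even ⟨
            u (c ℕ.+ opp c) (c ℕ.+ 0)    ≡⟨ cong₂ u (+-opp c) (ℕ.+-identityʳ c) ⟩
            u (c ℕ.* n) c                ≡⟨ cong (λ i → adj Γ i (idx c)) (idx-period 0 c) ⟩
            u 0 c                        ≡⟨ 0c ⟩
            true                         ∎

        -- The alternating vector and the bipartite case

        W : Mat n
        W i j = sgn (toℕ i)

        -- Both neighbours of vertex 1 on the cycle carry the sign 1, also across a wrap because `n`
        -- is even. Vertex 1 is chosen since `sumFin-cyclicAdj` treats vertices written as
        -- successors.
        CW : (C ⊛ W) (idx 1) (idx 1) ≡ + 2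
        CW = begin
          sumFin n (λ k → C (idx 1) k * sgn (toℕ k))
            ≡⟨ sumFin-cong (λ k → trans (alternating-row (cyclicAdj (idx 1) k) (toℕ k) (toℕ (idx 1)) (opposite k))
                 (cong₂ (λ x y → (- x) * y) (sgn-idx n-even 1) (C-sym (idx 1) k))) ⟩
          sumFin n (λ k → + 1 * C k (idx 1))
            ≡⟨ sumFin-cyclicAdj 3≤n (λ _ → + 1) 0 ⟩
          + 2 ∎
          where
          opposite : ∀ k → T (cyclicAdj (idx 1) k) → sgn (toℕ k) ≡ - sgn (toℕ (idx 1))
          opposite k t with cyclicAdj⇒next (idx 1) k t
          ... | inj₁ e = trans (sym (neg-involutive (sgn (toℕ k))))
                (cong -_ (sym (trans (cong (sgn ∘ toℕ) e) (sgn-idx n-even (suc (toℕ k))))))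
          ... | inj₂ e = trans (cong (sgn ∘ toℕ) (sym e)) (sgn-idx n-even (suc (toℕ (idx 1))))

        JW : sumFin n (sgn ∘ toℕ) ≡ + 0
        JW with k , n≡ ← half n n-even = trans (cong (λ m → sumFin m (sgn ∘ toℕ)) n≡) (sumFin-alternating k 0)

        module _ (0≁even : ∀ m → sgn m ≡ + 1 → u 0 m ≡ false) where

          -- Translation by -i moves the pair to (0, k - i). As `n` is even, -i has the parity of i,
          -- so k - i is even.
          even-nonadjacent : ∀ i k → sgn (i ℕ.+ k) ≡ + 1 → u i k ≡ false
          even-nonadjacent i k e = begin
            u i k                        ≡⟨ translate-even (opp i) i k e ⟨
            u (opp i ℕ.+ i) (opp i ℕ.+ k)  ≡⟨ cong (λ l → u l (opp i ℕ.+ k)) (trans (ℕ.+-comm (opp i) i) (+-opp i)) ⟩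
            u (i ℕ.* n) (opp i ℕ.+ k)    ≡⟨ cong (λ l → adj Γ l (idx (opp i ℕ.+ k))) (idx-period 0 i) ⟩
            u 0 (opp i ℕ.+ k)
              ≡⟨ 0≁even (opp i ℕ.+ k) (trans (sgn-+ (opp i) k)
                   (trans (cong (_* sgn k) opp-sgn) (trans (sym (sgn-+ i k)) e))) ⟩
            false                        ∎
            where
            opp-sgn : sgn (opp i) ≡ sgn i
            opp-sgn = trans (sgn-summand i (opp i))
              (trans (cong (λ m → sgn i * sgn m) (+-opp i))
                     (trans (cong (sgn i *_) (sgn-* i n n-even)) (*-identityʳ (sgn i))))

          AW : ∀ i j → (A ⊛ W) i j ≡ scale (- (+ suc q)) W i j
          AW i j = begin
            sumFin n (λ k → A i k * sgn (toℕ k))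
              ≡⟨ sumFin-cong (λ k → alternating-row (adj Γ i k) (toℕ k) (toℕ i) (opposite k)) ⟩
            sumFin n (λ k → (- sgn (toℕ i)) * A i k)
              ≡⟨ sumFin-* (- sgn (toℕ i)) (A i) ⟩
            (- sgn (toℕ i)) * sumFin n (A i)
              ≡⟨ cong ((- sgn (toℕ i)) *_) (reg i) ⟩
            (- sgn (toℕ i)) * + suc q
              ≡⟨ swap (sgn (toℕ i)) (+ suc q) ⟩
            (- (+ suc q)) * sgn (toℕ i) ∎
            where
            swap : ∀ s d → (- s) * d ≡ (- d) * s
            swap = solve-∀
            opposite : ∀ k → T (adj Γ i k) → sgn (toℕ k) ≡ - sgn (toℕ i)
            opposite k t with parity (toℕ i ℕ.+ toℕ k)
            ... | even e = ⊥-elim (subst T (trans (sym (cong₂ (adj Γ) (idx-toℕ i) (idx-toℕ k)))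
                                                  (even-nonadjacent (toℕ i) (toℕ k) e)) t)
            ... | odd  e = begin
              sgn (toℕ k)              ≡⟨ sgn-summand (toℕ i) (toℕ k) ⟩
              sgn (toℕ i) * sgn (toℕ i ℕ.+ toℕ k)  ≡⟨ cong (sgn (toℕ i) *_) e ⟩
              sgn (toℕ i) * -1ℤ                   ≡⟨ *-comm (sgn (toℕ i)) -1ℤ ⟩
              -1ℤ * sgn (toℕ i)                   ≡⟨ -1*i≡-i (sgn (toℕ i)) ⟩
              - sgn (toℕ i)                            ∎

          -- Apply G₄(A) to `W` and read the entry at vertex 1, where `W` is -1. The all-ones part
          -- contributes 0 and the cycle part 2ε, so the negated value of G₄ at -d is 2ε.
          Geval-at-neg-degree : Geval (suc q) 4 (- (+ suc q)) ≡ - (ε * + 2)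
          Geval-at-neg-degree = begin
            g                                          ≡⟨ neg-involutive g ⟨
            - - g                                      ≡⟨ cong -_ (-1*i≡-i g) ⟨
            - (-1ℤ * g)                           ≡⟨ cong -_ (*-comm -1ℤ g) ⟩
            - (g * -1ℤ)                           ≡⟨ cong (λ x → - (g * x)) (sgn-idx n-even 1) ⟨
            - (g * W o o)                              ≡⟨ cong -_ (Gpoly-eigenvector A W (suc q) {μ = - (+ suc q)} AW 4 o o) ⟨
            - (Gpoly (suc q) 4 A ⊛ W) o o
              ≡⟨ cong -_ (sumFin-cong (λ k → trans (cong (_* W k o) (G₄ o k)) (expand ε (C o k) (W k o)))) ⟩
            - sumFin n (λ k → W k o + ε * (C o k * W k o))  ≡⟨ cong -_ (sumFin-linear ε (λ k → W k o) (λ k → C o k * W k o)) ⟩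
            - (sumFin n (λ k → W k o) + ε * (C ⊛ W) o o)    ≡⟨ cong -_ (cong₂ (λ x y → x + ε * y) JW CW) ⟩
            - (+ 0 + ε * + 2)                          ≡⟨ cong -_ (+-identityˡ (ε * + 2)) ⟩
            - (ε * + 2)                                ∎
            where
            g = Geval (suc q) 4 (- (+ suc q))
            o : Fin n
            o = idx 1
            expand : ∀ ε c w → (+ 1 + ε * c) * w ≡ w + ε * (c * w)
            expand = solve-∀

        bipartite-impossible : ¬ (∀ m → sgn m ≡ + 1 → u 0 m ≡ false)
        bipartite-impossible 0≁even = too-large unit (trans (sym (Geval-neg-degree 2≤q)) (Geval-at-neg-degree 0≁even))
          where
          too-large : ∀ {ε m} → IsUnit ε → + (16 ℕ.+ m) ≢ - (ε * + 2)
          too-large (inj₁ refl) ()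
          too-large (inj₂ refl) ()

        not-reflective : ⊥
        not-reflective with x , y , 0x , 0y , x≢y , x+y≢0 ← two-neighbours with parity x | parity y
        ... | even x-even | even y-even =
              no-parallelogram x≢y x+y≢0 0x 0y (translate-even x 0 y y-even) (translate-even y 0 x x-even)
        ... | even x-even | odd  y-odd  = not-both-parities y-odd x-even 0y 0x
        -- One odd neighbour of 0 already rules out every even one, so the parity of `y` does not
        -- have to be inspected.
        ... | odd  x-odd  | _ = bipartite-impossible (λ m m-even → ¬-not (λ 0m → not-both-parities x-odd m-even 0x 0m))

      no-cyclic-graph : ⊥
      -- A nonzero value of `Δ` is refuted, and decidability of integer equality turns this into
      -- vanishing.
      no-cyclic-graph = not-circulant (λ m → decidable-stable (Δ 0 m ≟ + 0) not-reflective)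

-- Relabelling the vertices along the cycle, and the conclusion

relabel : ∀ {n} → Graph n → (Fin n → Fin n) → Graph n
relabel Γ p = record
  { adj    = λ i j → adj Γ (p i) (p j)
  ; symm   = λ i j → symm Γ (p i) (p j)
  ; irrefl = λ i → irrefl Γ (p i)
  }

module _ {n} (Γ : Graph n) {p : Fin n → Fin n} (bij : Bijective _≡_ _≡_ p) where

  sumFin-relabel : ∀ f → sumFin n (f ∘ p) ≡ sumFin n f
  sumFin-relabel = sumFin-permute (⤖⇒↔ (mk⤖ bij))

  relabel-regular : ∀ {d} → IsRegular Γ d → IsRegular (relabel Γ p) d
  relabel-regular reg i = trans (sumFin-relabel (adjMat Γ (p i))) (reg (p i))

  -- In the recursive case the sum over intermediate vertices is reindexed by the bijection `p`.
  Gpoly-relabel : ∀ d m i j → Gpoly d m (adjMat (relabel Γ p)) i j ≡ Gpoly d m (adjMat Γ) (p i) (p j)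
  Gpoly-relabel d zero          i j = sym (idMat-injective (proj₁ bij) i j)
  Gpoly-relabel d (suc zero)    i j = cong (λ x → adjMat Γ (p i) (p j) + x) (sym (idMat-injective (proj₁ bij) i j))
  Gpoly-relabel d (suc (suc m)) i j = cong₂ (λ x y → x - + (d ℕ.∸ 1) * y)
    (trans (sumFin-cong (λ k → cong (adjMat Γ (p i) (p k) *_) (Gpoly-relabel d (suc m) k j)))
           (sumFin-relabel (λ k → adjMat Γ (p i) k * Gpoly d (suc m) (adjMat Γ) k (p j))))
    (Gpoly-relabel d m i j)

-- Relabelling by the ordering `p` turns `B` into the standard cycle `cyclicAdj`; the unit `ε`
-- treats defect and excess together.
no-cyclic-matrix : ∀ {n d} (Γ : Graph n) {ε} {B : Mat n} → IsUnit ε → 3 ℕ.≤ n → IsRegular Γ d → 3 ℕ.≤ d →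
                   IsCycleMatrix B → ¬ (∀ i j → Gpoly d 4 (adjMat Γ) i j ≡ + 1 + ε * B i j)
no-cyclic-matrix {suc n} {suc q} Γ {ε} unit 3≤n reg (ℕ.s≤s 2≤q) (p , bij , B≡C) G₄ =
  no-cyclic-graph 3≤n (relabel Γ p) (relabel-regular Γ bij reg) unit
    (λ i j → trans (Gpoly-relabel Γ bij (suc q) 4 i j)
      (trans (G₄ (p i) (p j)) (cong (λ b → + 1 + ε * b) (B≡C i j))))
    2≤q

theorem1 : ((n d : ℕ) (Γ : Graph n) → ¬ CyclicDefect Γ d 4) ×
    ((n d : ℕ) (Γ : Graph n) → Odd d → ¬ CyclicExcess Γ d 9)
theorem1 =
    (λ { n d Γ (3≤n , reg , 3≤d , _ , _ , B , cycle , G₄) →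
      no-cyclic-matrix Γ {+ 1} {B} (inj₁ refl) 3≤n reg 3≤d cycle
        (λ i j → trans (G₄ i j) (cong (λ b → + 1 + b) (sym (*-identityˡ (B i j))))) })
  -- As `9 / 2` computes to 4, excess leads to the same matrix equation with ε = -1.
  , (λ { n d Γ _ (3≤n , reg , 3≤d , _ , _ , _ , B , cycle , G₄) →
      no-cyclic-matrix Γ { -1ℤ } {B} (inj₂ refl) 3≤n reg 3≤d cycle
        (λ i j → trans (G₄ i j) (cong (λ b → + 1 + b) (sym (-1*i≡-i (B i j))))) })
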